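{- The FPARS $(\Lambda_{\mathsf{WN}},\mathsf{U})$, i.e. the set of weakly normalising $\lambda$-terms equipped with the uniform randomised reduction strategy, is not positive almost-surely terminating (PAST).
   Context: $\lambda$-terms: $\Lambda$ is the set of untyped $\lambda$-terms $M,N ::= x \mid MN \mid \lambda x.M$ ($x$ in a countably infinite set of variables), modulo $\alpha$-equivalence. A $\beta$-redex is a term $(\lambda x.M)N$; its contractum is $M\{N/x\}$ (capture-avoiding substitution). $M\to_\beta N$ means that $N$ is obtained from $M$ by replacing one occurrence of a redex in $M$ (anywhere in the term) by its contractum. A term is in normal form if it has no $\beta$-reduct, reducible otherwise; it is weakly normalising if some $\beta$-reduction sequence from it reaches a normal form. $\Lambda_{\mathsf{WN}}$ is the set of weakly normalising terms. An abstract reduction system (ARS) is a pair $(A,\to)$ with $A$ at most countable and $\to\,\subseteq A\times A$. A randomised reduction strategy for $(A,\to)$ is a partial function $\mathsf{P}$ from $A$ to probability distributions on $A$ such that $\mathsf{P}(a)$ is undefined iff $a$ is in normal form, and if $\mathsf{P}(a)=\mu$ then $\mu(b)>0$ implies $a\to b$. The pair $(A,\mathsf{P})$ is then called a fully probabilistic abstract reduction system (FPARS). Put $\mathbb{P}(a\to b)=\mu(b)$ if $\mathsf{P}(a)=\mu$, and $\mathbb{P}(a\to b)=0$ if $\mathsf{P}(a)$ is undefined. For $a\in A$, the computation starting from $a$ is the sequence of partial distributions $(\rho_i)_{i\in\mathbb{N}}$ with $\rho_0(a)=1$ (Dirac at $a$) and $\rho_{i+1}(c)=\sum_{b\in A}\rho_i(b)\,\mathbb{P}(b\to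 c)$. Write $|\rho|=\sum_{b}\rho(b)$ and $\mathsf{Steps}_{\mathsf{P}}(a)=\sum_{i=1}^\infty|\rho_i|\in[0,+\infty]$. The FPARS is PAST if $\mathsf{Steps}_{\mathsf{P}}(a)<+\infty$ for every $a\in A$. The uniform strategy $\mathsf{U}$: for a reducible term $M$, $\mathsf{U}(M)=\mu$ with $\mu(N)=|\mathcal{R}_{M\to N}|/|\mathcal{R}_M|$, where $\mathcal{R}_M$ is the set of redex occurrences of $M$ and $\mathcal{R}_{M\to N}$ is the set of redex occurrences $R\in\mathcal{R}_M$ such that firing $R$ in $M$ gives $N$. $(\Lambda_{\mathsf{WN}},\mathsf{U})$ denotes $\mathsf{U}$ restricted to $\Lambda_{\mathsf{WN}}$ (which is closed under $\beta$-reduction). -}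

module Defs where

open import Data.Bool.Base using (if_then_else_)
open import Data.Integer.Base as ℤ using (+_)
import Data.Integer.Properties as ℤₚ
import Data.Irrelevant as Irrelevant
open import Data.List.Base
  using (List; []; _∷_; _++_; map; concatMap; filter; deduplicate; foldr; length)
open import Data.List.Membership.Propositional using (_∈_; _∉_; lose)
open import Data.List.Membership.Propositional.Properties
  using (∈-map⁺; ∈-map⁻; ∈-++⁺ˡ; ∈-++⁺ʳ; ∈-concatMap⁺; ∈-filter⁻; ∈-deduplicate⁺; ∈-deduplicate⁻)
open import Data.List.Relation.Unary.All as All using (All; []; _∷_)
open import Data.List.Relation.Unary.Any using (here; there)
open import Data.List.Relation.Unary.AllPairs using ([]; _∷_)
open import Data.List.Relation.Unary.Unique.Propositional using (Unique)
import Data.List.Relation.Unary.Unique.Propositional.Properties as Uniqueₚ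
import Data.List.Relation.Unary.Unique.DecPropositional.Properties as DecUniqueₚ
open import Data.Maybe.Base using (Maybe; just; nothing; maybe′)
open import Data.Nat.Base as ℕ using (ℕ; zero; suc; NonZero)
import Data.Nat.Properties as ℕₚ
open import Data.Product.Base using (∃-syntax; _×_; _,_; proj₁; proj₂)
open import Data.Rational.Base using (ℚ; 0ℚ; 1ℚ; _/_; _+_; _*_; _≤_; _<_; toℚᵘ)
import Data.Rational.Properties as ℚₚ
import Data.Rational.Unnormalised.Base as ℚᵘ
import Data.Rational.Unnormalised.Properties as ℚᵘₚ
open import Data.Refinement as Refinement using (Refinement; value; proof; value-injective)
  renaming (_,_ to _∣_)
open import Function.Base using (_∘_)
open import Function.Bundles using (_⇔_; mk⇔; _↣_; mk↣; Injection)
open import Relation.Binary.Construct.Closure.ReflexiveTransitive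
  using (Star; ε; _◅_; _◅◅_; gmap)
open import Relation.Binary.Definitions using (DecidableEquality; _Respects_)
open import Relation.Binary.PropositionalEquality
  using (_≡_; _≢_; refl; sym; trans; cong; cong₂; subst)
open import Relation.Binary.Rewriting using (IsNormalForm; HasNormalForm)
open import Relation.Nullary using (¬_; yes; no; does; contradiction)
open import Relation.Nullary.Decidable using (map′)

------------------------------------------------------------------------
-- Finitely supported functions A → ℚ.  The support may list points of
-- weight 0, but lists no point twice, so summing over it is summing over A.

∑[_] : ∀ {A : Set} → List A → (A → ℚ) → ℚ
∑[ xs ] f = foldr (λ x s → f x + s) 0ℚ xs

record FinSupp (A : Set) : Set where
  field
    weight   : A → ℚ
    support  : List A
    unique   : Unique support
    vanishes : ∀ {a} → a ∉ support → weight a ≡ 0ℚ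

  mass : ℚ
  mass = ∑[ support ] weight

open FinSupp public

record Distribution (A : Set) : Set where
  field
    finSupp : FinSupp A
    nonneg  : ∀ a → 0ℚ ≤ weight finSupp a
    total   : mass finSupp ≡ 1ℚ

open Distribution public

------------------------------------------------------------------------
-- Abstract reduction systems and randomised strategies.

-- Decidable equality already follows from countability; having it as a
-- field avoids computing with codes.

record ARS : Set₁ where
  field
    Carrier   : Set
    countable : Carrier ↣ ℕ
    _≟_       : DecidableEquality Carrier
    _⟶_       : Carrier → Carrier → Set

-- Distributions are finitely supported and rational-valued, which keeps all
-- the ρ i below of the same kind.

record RandomisedStrategy (𝒜 : ARS) : Set where
  open ARS 𝒜
  field
    P            : Carrier → Maybe (Distribution Carrier)
    undefined⇔nf : ∀ a → P a ≡ nothing ⇔ IsNormalForm _⟶_ a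
    sound        : ∀ {a μ} → P a ≡ just μ → ∀ {b} → 0ℚ < weight (finSupp μ) b → a ⟶ b

record FPARS : Set₁ where
  field
    ars      : ARS
    strategy : RandomisedStrategy ars

  open ARS ars public
  open RandomisedStrategy strategy public

  ℙ : Carrier → Carrier → ℚ
  ℙ a b = maybe′ (λ μ → weight (finSupp μ) b) 0ℚ (P a)

  successors : Carrier → List Carrier
  successors a = maybe′ (support ∘ finSupp) [] (P a)

  ℙ-vanishes : ∀ a {b} → b ∉ successors a → ℙ a b ≡ 0ℚ
  ℙ-vanishes a b∉ with P a
  ... | just μ  = vanishes (finSupp μ) b∉
  ... | nothing = refl

  dirac : Carrier → FinSupp Carrier
  dirac a .weight b       = if does (b ≟ a) then 1ℚ else 0ℚ
  dirac a .support        = a ∷ []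
  dirac a .unique         = [] ∷ []
  dirac a .vanishes {b} b∉ with b ≟ a
  ... | yes b≡a = contradiction (here b≡a) b∉
  ... | no  _   = refl

  private
    ∑-zero : (xs : List Carrier) (f : Carrier → ℚ) → (∀ {b} → b ∈ xs → f b ≡ 0ℚ) → ∑[ xs ] f ≡ 0ℚ
    ∑-zero []       f f≡0 = refl
    ∑-zero (x ∷ xs) f f≡0 = cong₂ _+_ (f≡0 (here refl)) (∑-zero xs f (f≡0 ∘ there))

  next : FinSupp Carrier → FinSupp Carrier
  next ρ .weight c = ∑[ support ρ ] λ b → weight ρ b * ℙ b c
  next ρ .support  = deduplicate _≟_ (concatMap successors (support ρ))
  next ρ .unique   = DecUniqueₚ.deduplicate-! _≟_ (concatMap successors (support ρ))
  next ρ .vanishes {c} c∉ = ∑-zero (support ρ) _ λ {b} b∈ →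
    trans (cong (weight ρ b *_) (ℙ-vanishes b λ c∈ →
             c∉ (∈-deduplicate⁺ _≟_ (∈-concatMap⁺ successors (lose b∈ c∈)))))
          (ℚₚ.*-zeroʳ (weight ρ b))

  computation : Carrier → ℕ → FinSupp Carrier
  computation a zero    = dirac a
  computation a (suc i) = next (computation a i)

  -- Σ_{i=1}^n |ρ i|
  partialSteps : Carrier → ℕ → ℚ
  partialSteps a zero    = 0ℚ
  partialSteps a (suc n) = partialSteps a n + mass (computation a (suc n))

  -- The terms of the series are nonnegative, so its sum in [0,+∞] is finite
  -- exactly when the partial sums are bounded.
  Steps<∞ : Carrier → Set
  Steps<∞ a = ∃[ q ] ∀ n → partialSteps a n ≤ q

  PAST : Set
  PAST = ∀ a → Steps<∞ a

------------------------------------------------------------------------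
-- λ-terms modulo α, with de Bruijn indices: under k binders, the index
-- k + x is the free variable x.

infixl 7 _·_
infixr 6 ƛ_

data Term : Set where
  var : ℕ → Term
  _·_ : Term → Term → Term
  ƛ_  : Term → Term

ext : (ℕ → ℕ) → ℕ → ℕ
ext ρ zero    = zero
ext ρ (suc x) = suc (ρ x)

rename : (ℕ → ℕ) → Term → Term
rename ρ (var x) = var (ρ x)
rename ρ (M · N) = rename ρ M · rename ρ N
rename ρ (ƛ M)   = ƛ rename (ext ρ) M

exts : (ℕ → Term) → ℕ → Term
exts σ zero    = var zero
exts σ (suc x) = rename suc (σ x)

subst-term : (ℕ → Term) → Term → Term
subst-term σ (var x) = σ x
subst-term σ (M · N) = subst-term σ M · subst-term σ N
subst-term σ (ƛ M)   = ƛ subst-term (exts σ) M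

single : Term → ℕ → Term
single N zero    = N
single N (suc x) = var x

infix 8 _[_]

_[_] : Term → Term → Term
M [ N ] = subst-term (single N) M

data Redex : Term → Set where
  root  : ∀ {M N} → Redex ((ƛ M) · N)
  left  : ∀ {M N} → Redex M → Redex (M · N)
  right : ∀ {M N} → Redex N → Redex (M · N)
  under : ∀ {M} → Redex M → Redex (ƛ M)

fire : ∀ {M} → Redex M → Term
fire (root {M} {N})      = M [ N ]
fire (left {N = N} R)    = fire R · N
fire (right {M = M} R)   = M · fire R
fire (under R)           = ƛ fire R

infix 4 _→β_

_→β_ : Term → Term → Set
M →β N = ∃[ R ] fire {M} R ≡ N

WN : Term → Set
WN = HasNormalForm _→β_

rootRedexes : ∀ M N → List (Redex (M · N))
rootRedexes (var x) N = []
rootRedexes (L · M) N = []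
rootRedexes (ƛ M)   N = root ∷ []

redexes : ∀ M → List (Redex M)
redexes (var x) = []
redexes (M · N) = rootRedexes M N ++ map left (redexes M) ++ map right (redexes N)
redexes (ƛ M)   = map under (redexes M)

redexes-complete : ∀ {M} (R : Redex M) → R ∈ redexes M
redexes-complete root = here refl
redexes-complete (left {M} {N} R) =
  ∈-++⁺ʳ (rootRedexes M N) (∈-++⁺ˡ (∈-map⁺ left (redexes-complete R)))
redexes-complete (right {M} {N} R) =
  ∈-++⁺ʳ (rootRedexes M N) (∈-++⁺ʳ (map left (redexes M)) (∈-map⁺ right (redexes-complete R)))
redexes-complete (under R) = ∈-map⁺ under (redexes-complete R)

redexes-unique : ∀ M → Unique (redexes M)
redexes-unique (var x) = []
redexes-unique (M · N) =
  Uniqueₚ.++⁺ (root! M)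
    (Uniqueₚ.++⁺ (Uniqueₚ.map⁺ (λ { refl → refl }) (redexes-unique M))
                 (Uniqueₚ.map⁺ (λ { refl → refl }) (redexes-unique N))
                 left#right)
    (root# M)
  where
  root! : ∀ M → Unique (rootRedexes M N)
  root! (var x) = []
  root! (L · M) = []
  root! (ƛ M)   = [] ∷ []

  left#right : ∀ {R} → ¬ (R ∈ map left (redexes M) × R ∈ map right (redexes N))
  left#right (∈l , ∈r) with ∈-map⁻ left ∈l | ∈-map⁻ right ∈r
  ... | _ , _ , refl | _ , _ , ()

  root∉ : ∀ {M} {Rs : List (Redex (ƛ M))} {Ss : List (Redex N)} → root ∉ map left Rs ++ map right Ss
  root∉ {Rs = []} {S ∷ Ss} (there p) = root∉ {Rs = []} p
  root∉ {Rs = R ∷ Rs}      (there p) = root∉ {Rs = Rs} p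

  root# : ∀ M {R : Redex (M · N)} →
          ¬ (R ∈ rootRedexes M N × R ∈ map left (redexes M) ++ map right (redexes N))
  root# (ƛ M) (here refl , p) = root∉ {Rs = redexes (ƛ M)} p
redexes-unique (ƛ M) = Uniqueₚ.map⁺ (λ { refl → refl }) (redexes-unique M)

infix 4 _≟ₜ_

_≟ₜ_ : DecidableEquality Term
var x ≟ₜ var y = map′ (cong var) (λ { refl → refl }) (x ℕₚ.≟ y)
var x ≟ₜ M · N = no λ ()
var x ≟ₜ ƛ M   = no λ ()
L · M ≟ₜ var x = no λ ()
K · L ≟ₜ M · N with K ≟ₜ M | L ≟ₜ N
... | yes refl | yes refl = yes refl
... | no K≢M   | _        = no λ { refl → K≢M refl }
... | _        | no L≢N   = no λ { refl → L≢N refl }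
L · M ≟ₜ ƛ N   = no λ ()
ƛ M   ≟ₜ var x = no λ ()
ƛ L   ≟ₜ M · N = no λ ()
ƛ M   ≟ₜ ƛ N   = map′ (cong ƛ_) (λ { refl → refl }) (M ≟ₜ N)

private
  odd≢even : ∀ m n → suc (m ℕ.+ m) ≢ n ℕ.+ n
  odd≢even zero    (suc zero)    ()
  odd≢even zero    (suc (suc n)) ()
  odd≢even (suc m) (suc n) eq = odd≢even m n
    (ℕₚ.suc-injective (ℕₚ.suc-injective
      (trans (cong (suc ∘ suc) (sym (ℕₚ.+-suc m m))) (trans eq (cong suc (ℕₚ.+-suc n n))))))

  double-injective : ∀ m n → m ℕ.+ m ≡ n ℕ.+ n → m ≡ n
  double-injective m n eq =
    trans (ℕₚ.n≡⌊n+n/2⌋ m) (trans (cong ℕ.⌊_/2⌋ eq) (sym (ℕₚ.n≡⌊n+n/2⌋ n)))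

  opaque
    -- 2 ^ a * (2 * b + 1)
    pair : ℕ → ℕ → ℕ
    pair zero    b = suc (b ℕ.+ b)
    pair (suc a) b = pair a b ℕ.+ pair a b

    pair-injective : ∀ a {b} a′ {b′} → pair a b ≡ pair a′ b′ → a ≡ a′ × b ≡ b′
    pair-injective zero    {b} zero     {b′} eq = refl , double-injective b b′ (ℕₚ.suc-injective eq)
    pair-injective zero    {b} (suc a′) {b′} eq = contradiction eq (odd≢even b (pair a′ b′))
    pair-injective (suc a) {b} zero     {b′} eq = contradiction (sym eq) (odd≢even b′ (pair a b))
    pair-injective (suc a) {b} (suc a′) {b′} eq
      with pair-injective a a′ (double-injective (pair a b) (pair a′ b′) eq)
    ... | refl , refl = refl , refl

  code : Term → ℕ
  code (var x) = pair 0 x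
  code (M · N) = pair 1 (pair (code M) (code N))
  code (ƛ M)   = pair 2 (code M)

  code-injective : ∀ M N → code M ≡ code N → M ≡ N
  code-injective (var x) (var y) eq = cong var (proj₂ (pair-injective 0 0 eq))
  code-injective (var x) (M · N) eq = contradiction (proj₁ (pair-injective 0 1 eq)) λ ()
  code-injective (var x) (ƛ M)   eq = contradiction (proj₁ (pair-injective 0 2 eq)) λ ()
  code-injective (L · M) (var x) eq = contradiction (proj₁ (pair-injective 1 0 eq)) λ ()
  code-injective (K · L) (M · N) eq with pair-injective (code K) (code M) (proj₂ (pair-injective 1 1 eq))
  ... | eq₁ , eq₂ = cong₂ _·_ (code-injective K M eq₁) (code-injective L N eq₂)
  code-injective (L · M) (ƛ N)   eq = contradiction (proj₁ (pair-injective 1 2 eq)) λ ()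
  code-injective (ƛ M)   (var x) eq = contradiction (proj₁ (pair-injective 2 0 eq)) λ ()
  code-injective (ƛ L)   (M · N) eq = contradiction (proj₁ (pair-injective 2 1 eq)) λ ()
  code-injective (ƛ M)   (ƛ N)   eq = cong ƛ_ (code-injective M N (proj₂ (pair-injective 2 2 eq)))

Term-countable : Term ↣ ℕ
Term-countable = mk↣ (code-injective _ _)

------------------------------------------------------------------------
-- Weakly normalising terms are closed under β, by Takahashi's argument:
-- every parallel reduct of M reduces in parallel to M ⁺.

private
  rename-cong : ∀ {ρ ρ′} → (∀ x → ρ x ≡ ρ′ x) → ∀ M → rename ρ M ≡ rename ρ′ M
  rename-cong eq (var x) = cong var (eq x)
  rename-cong eq (M · N) = cong₂ _·_ (rename-cong eq M) (rename-cong eq N)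
  rename-cong eq (ƛ M)   = cong ƛ_ (rename-cong (λ { zero → refl ; (suc x) → cong suc (eq x) }) M)

  subst-cong : ∀ {σ τ} → (∀ x → σ x ≡ τ x) → ∀ M → subst-term σ M ≡ subst-term τ M
  subst-cong eq (var x) = eq x
  subst-cong eq (M · N) = cong₂ _·_ (subst-cong eq M) (subst-cong eq N)
  subst-cong eq (ƛ M)   =
    cong ƛ_ (subst-cong (λ { zero → refl ; (suc x) → cong (rename suc) (eq x) }) M)

  subst-var : ∀ {σ} → (∀ x → σ x ≡ var x) → ∀ M → subst-term σ M ≡ M
  subst-var eq (var x) = eq x
  subst-var eq (M · N) = cong₂ _·_ (subst-var eq M) (subst-var eq N)
  subst-var eq (ƛ M)   =
    cong ƛ_ (subst-var (λ { zero → refl ; (suc x) → cong (rename suc) (eq x) }) M)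

  rename-rename : ∀ {ρ ρ′} M → rename ρ′ (rename ρ M) ≡ rename (ρ′ ∘ ρ) M
  rename-rename (var x) = refl
  rename-rename (M · N) = cong₂ _·_ (rename-rename M) (rename-rename N)
  rename-rename (ƛ M)   = cong ƛ_
    (trans (rename-rename M) (rename-cong (λ { zero → refl ; (suc x) → refl }) M))

  subst-rename : ∀ {ρ σ} M → subst-term σ (rename ρ M) ≡ subst-term (σ ∘ ρ) M
  subst-rename (var x) = refl
  subst-rename (M · N) = cong₂ _·_ (subst-rename M) (subst-rename N)
  subst-rename (ƛ M)   = cong ƛ_
    (trans (subst-rename M) (subst-cong (λ { zero → refl ; (suc x) → refl }) M))

  rename-subst : ∀ {ρ σ} M → rename ρ (subst-term σ M) ≡ subst-term (rename ρ ∘ σ) M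
  rename-subst (var x) = refl
  rename-subst (M · N) = cong₂ _·_ (rename-subst M) (rename-subst N)
  rename-subst {ρ} {σ} (ƛ M) = cong ƛ_ (trans (rename-subst M) (subst-cong
    (λ { zero → refl ; (suc x) → trans (rename-rename (σ x)) (sym (rename-rename (σ x))) }) M))

  subst-subst : ∀ {σ τ} M → subst-term τ (subst-term σ M) ≡ subst-term (subst-term τ ∘ σ) M
  subst-subst (var x) = refl
  subst-subst (M · N) = cong₂ _·_ (subst-subst M) (subst-subst N)
  subst-subst {σ} {τ} (ƛ M) = cong ƛ_ (trans (subst-subst M) (subst-cong
    (λ { zero → refl ; (suc x) → trans (subst-rename (σ x)) (sym (rename-subst (σ x))) }) M))

  rename-[] : ∀ {ρ} M N → rename (ext ρ) M [ rename ρ N ] ≡ rename ρ (M [ N ])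
  rename-[] M N = trans (subst-rename M)
    (trans (subst-cong (λ { zero → refl ; (suc x) → refl }) M) (sym (rename-subst M)))

  subst-[] : ∀ {σ} M N → subst-term (exts σ) M [ subst-term σ N ] ≡ subst-term σ (M [ N ])
  subst-[] {σ} M N = trans (subst-subst M)
    (trans (subst-cong (λ { zero → refl
                          ; (suc x) → trans (subst-rename (σ x)) (subst-var (λ _ → refl) (σ x)) }) M)
           (sym (subst-subst M)))

  infix 4 _⇛_ _↠_

  data _⇛_ : Term → Term → Set where
    var  : ∀ x → var x ⇛ var x
    _·_  : ∀ {M M′ N N′} → M ⇛ M′ → N ⇛ N′ → M · N ⇛ M′ · N′
    ƛ_   : ∀ {M M′} → M ⇛ M′ → ƛ M ⇛ ƛ M′
    beta : ∀ {M M′ N N′} → M ⇛ M′ → N ⇛ N′ → (ƛ M) · N ⇛ M′ [ N′ ]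

  _↠_ : Term → Term → Set
  _↠_ = Star _→β_

  ⇛-refl : ∀ {M} → M ⇛ M
  ⇛-refl {var x} = var x
  ⇛-refl {M · N} = ⇛-refl · ⇛-refl
  ⇛-refl {ƛ M}   = ƛ ⇛-refl

  ⇛-rename : ∀ {ρ M M′} → M ⇛ M′ → rename ρ M ⇛ rename ρ M′
  ⇛-rename (var x) = ⇛-refl
  ⇛-rename (p · q) = ⇛-rename p · ⇛-rename q
  ⇛-rename (ƛ p)   = ƛ ⇛-rename p
  ⇛-rename (beta {M′ = M′} {N′ = N′} p q) =
    subst (_ ⇛_) (rename-[] M′ N′) (beta (⇛-rename p) (⇛-rename q))

  ⇛-subst : ∀ {σ τ M M′} → (∀ x → σ x ⇛ τ x) → M ⇛ M′ → subst-term σ M ⇛ subst-term τ M′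
  ⇛-exts : ∀ {σ τ} → (∀ x → σ x ⇛ τ x) → ∀ x → exts σ x ⇛ exts τ x
  ⇛-exts s zero    = ⇛-refl
  ⇛-exts s (suc x) = ⇛-rename (s x)
  ⇛-subst s (var x) = s x
  ⇛-subst s (p · q) = ⇛-subst s p · ⇛-subst s q
  ⇛-subst s (ƛ p)   = ƛ ⇛-subst (⇛-exts s) p
  ⇛-subst s (beta {M′ = M′} {N′ = N′} p q) =
    subst (_ ⇛_) (subst-[] M′ N′) (beta (⇛-subst (⇛-exts s) p) (⇛-subst s q))

  ⇛-[] : ∀ {M M′ N N′} → M ⇛ M′ → N ⇛ N′ → M [ N ] ⇛ M′ [ N′ ]
  ⇛-[] p q = ⇛-subst (λ { zero → q ; (suc x) → var x }) p

  infix 9 _⁺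

  _⁺ : Term → Term
  (var x) ⁺       = var x
  (ƛ M) ⁺         = ƛ M ⁺
  (var x · N) ⁺   = var x · N ⁺
  (L · M · N) ⁺   = (L · M) ⁺ · N ⁺
  ((ƛ M) · N) ⁺   = M ⁺ [ N ⁺ ]

  ⇛-triangle : ∀ {M N} → M ⇛ N → N ⇛ M ⁺
  ⇛-triangle (var x)                 = var x
  ⇛-triangle (ƛ p)                   = ƛ ⇛-triangle p
  ⇛-triangle (beta p q)              = ⇛-[] (⇛-triangle p) (⇛-triangle q)
  ⇛-triangle (_·_ {M = var x} p q)   = ⇛-triangle p · ⇛-triangle q
  ⇛-triangle (_·_ {M = L · M} p q)   = ⇛-triangle p · ⇛-triangle q
  ⇛-triangle (_·_ {M = ƛ M} (ƛ p) q) = beta (⇛-triangle p) (⇛-triangle q)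

  →β⇒⇛ : ∀ {M} (R : Redex M) → M ⇛ fire R
  →β⇒⇛ root      = beta ⇛-refl ⇛-refl
  →β⇒⇛ (left R)  = →β⇒⇛ R · ⇛-refl
  →β⇒⇛ (right R) = ⇛-refl · →β⇒⇛ R
  →β⇒⇛ (under R) = ƛ →β⇒⇛ R

  ↠-app : ∀ {M M′ N N′} → M ↠ M′ → N ↠ N′ → M · N ↠ M′ · N′
  ↠-app p q = gmap (_· _) (λ { (R , refl) → left R , refl }) p
           ◅◅ gmap (_ ·_) (λ { (R , refl) → right R , refl }) q

  ↠-ƛ : ∀ {M M′} → M ↠ M′ → ƛ M ↠ ƛ M′
  ↠-ƛ = gmap ƛ_ λ { (R , refl) → under R , refl }

  ⇛⇒↠ : ∀ {M N} → M ⇛ N → M ↠ N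
  ⇛⇒↠ (var x)    = ε
  ⇛⇒↠ (p · q)    = ↠-app (⇛⇒↠ p) (⇛⇒↠ q)
  ⇛⇒↠ (ƛ p)      = ↠-ƛ (⇛⇒↠ p)
  ⇛⇒↠ (beta p q) = ↠-app (↠-ƛ (⇛⇒↠ p)) (⇛⇒↠ q) ◅◅ (root , refl) ◅ ε

  strip : ∀ {M N V} → M ⇛ N → M ↠ V → ∃[ W ] N ↠ W × V ⇛ W
  strip p ε = _ , ε , p
  strip {M} p ((R , refl) ◅ rs) with strip (⇛-triangle (→β⇒⇛ R)) rs
  ... | W , r , q = W , (⇛⇒↠ (⇛-triangle p) ◅◅ r) , q

  nf-↠ : ∀ {V W} → IsNormalForm _→β_ V → V ↠ W → V ≡ W
  nf-↠ nf ε       = refl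
  nf-↠ nf (r ◅ _) = contradiction (_ , r) nf

WN-closed : WN Respects _→β_
WN-closed (R , refl) (V , nf , r) with strip (→β⇒⇛ R) r
... | W , s , q with nf-↠ nf (⇛⇒↠ q)
...   | refl = V , nf , s

------------------------------------------------------------------------
-- The image under f of the uniform distribution on the list rs:
-- a has weight |{ r ∈ rs | f r = a }| / |rs|.

module _ {R A : Set} (_≟_ : DecidableEquality A) (f : R → A) where

  fibre : List R → A → List R
  fibre rs a = filter (λ r → f r ≟ a) rs

  private
    #fibres : List A → List R → ℕ
    #fibres as rs = foldr (λ a n → length (fibre rs a) ℕ.+ n) 0 as

    #fibres-[] : ∀ as → #fibres as [] ≡ 0
    #fibres-[] []       = refl
    #fibres-[] (a ∷ as) = #fibres-[] as

    #fibres-∉ : ∀ {as r} rs → f r ∉ as → #fibres as (r ∷ rs) ≡ #fibres as rs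
    #fibres-∉ {[]}         rs r∉ = refl
    #fibres-∉ {a ∷ as} {r} rs r∉ with f r ≟ a
    ... | yes fr≡a = contradiction (here fr≡a) r∉
    ... | no  _    = cong (length (fibre rs a) ℕ.+_) (#fibres-∉ rs (r∉ ∘ there))

    #fibres-∷ : ∀ {as r} rs → Unique as → f r ∈ as → #fibres as (r ∷ rs) ≡ suc (#fibres as rs)
    #fibres-∷ {a ∷ as} {r} rs (a# ∷ _) r∈ with f r ≟ a
    ... | yes refl = cong (λ n → suc (length (fibre rs a) ℕ.+ n))
                          (#fibres-∉ rs (λ p → All.lookup a# p refl))
    #fibres-∷ {a ∷ as} {r} rs (_ ∷ _)   (here fr≡a) | no fr≢a = contradiction fr≡a fr≢a
    #fibres-∷ {a ∷ as} {r} rs (_ ∷ as!) (there r∈)  | no _    =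
      trans (cong (length (fibre rs a) ℕ.+_) (#fibres-∷ rs as! r∈)) (ℕₚ.+-suc _ _)

    #fibres-length : ∀ {as} rs → Unique as → All (λ r → f r ∈ as) rs → #fibres as rs ≡ length rs
    #fibres-length {as} []       as! _          = #fibres-[] as
    #fibres-length      (r ∷ rs) as! (r∈ ∷ rs∈) =
      trans (#fibres-∷ rs as! r∈) (cong suc (#fibres-length rs as! rs∈))

    /-+ : ∀ m n k .{{_ : NonZero k}} → + m / k + + n / k ≡ + (m ℕ.+ n) / k
    /-+ m n k@(suc k-1) = ℚₚ.toℚᵘ-injective (begin
      toℚᵘ (+ m / k + + n / k)            ≈⟨ ℚₚ.toℚᵘ-homo-+ (+ m / k) (+ n / k) ⟩
      toℚᵘ (+ m / k) ℚᵘ.+ toℚᵘ (+ n / k)  ≈⟨ ℚᵘₚ.+-cong (ℚₚ.toℚᵘ-fromℚᵘ (m /ᵘ)) (ℚₚ.toℚᵘ-fromℚᵘ (n /ᵘ)) ⟩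
      m /ᵘ ℚᵘ.+ n /ᵘ                      ≈⟨ ℚᵘ.*≡* common ⟩
      (m ℕ.+ n) /ᵘ                        ≈⟨ ℚₚ.toℚᵘ-fromℚᵘ ((m ℕ.+ n) /ᵘ) ⟨
      toℚᵘ (+ (m ℕ.+ n) / k)              ∎)
      where
      open ℚᵘₚ.≃-Reasoning
      _/ᵘ : ℕ → ℚᵘ.ℚᵘ
      a /ᵘ = ℚᵘ.mkℚᵘ (+ a) k-1

      common : (+ m ℤ.* + k ℤ.+ + n ℤ.* + k) ℤ.* + k ≡ + (m ℕ.+ n) ℤ.* + (k ℕ.* k)
      common =
        trans (cong (ℤ._* + k) (sym (ℤₚ.*-distribʳ-+ (+ k) (+ m) (+ n))))
          (trans (ℤₚ.*-assoc (+ m ℤ.+ + n) (+ k) (+ k))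
                 (cong₂ ℤ._*_ (sym (ℤₚ.pos-+ m n)) (sym (ℤₚ.pos-* k k))))

    ∑-/ : ∀ as rs k .{{_ : NonZero k}} →
          ∑[ as ] (λ a → + length (fibre rs a) / k) ≡ + #fibres as rs / k
    ∑-/ []       rs k = sym (ℚₚ.0/n≡0 k)
    ∑-/ (a ∷ as) rs k =
      trans (cong (_+_ (+ length (fibre rs a) / k)) (∑-/ as rs k)) (/-+ (length (fibre rs a)) (#fibres as rs) k)

    n/n : ∀ n .{{_ : NonZero n}} → + n / n ≡ 1ℚ
    n/n n@(suc n-1) = ℚₚ.fromℚᵘ-cong {ℚᵘ.mkℚᵘ (+ n) n-1} {ℚᵘ.1ℚᵘ} (ℚᵘ.*≡* (ℤₚ.*-comm (+ n) (+ 1)))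

    fibre-∉ : ∀ rs {a} → a ∉ map f rs → length (fibre rs a) ≡ 0
    fibre-∉ []       a∉ = refl
    fibre-∉ (r ∷ rs) {a} a∉ with f r ≟ a
    ... | yes fr≡a = contradiction (here (sym fr≡a)) a∉
    ... | no  _    = fibre-∉ rs (a∉ ∘ there)

  uniform : (rs : List R) .{{_ : NonZero (length rs)}} → Distribution A
  uniform rs .finSupp .weight a   = + length (fibre rs a) / length rs
  uniform rs .finSupp .support    = deduplicate _≟_ (map f rs)
  uniform rs .finSupp .unique     = DecUniqueₚ.deduplicate-! _≟_ (map f rs)
  uniform rs .finSupp .vanishes {a} a∉ =
    trans (cong (λ n → + n / length rs) (fibre-∉ rs (a∉ ∘ ∈-deduplicate⁺ _≟_)))
          (ℚₚ.0/n≡0 (length rs))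
  uniform rs .nonneg a =
    ℚₚ.nonNegative⁻¹ _ {{ℚₚ.normalize-nonNeg (length (fibre rs a)) (length rs)}}
  uniform rs .total =
    trans (∑-/ (deduplicate _≟_ (map f rs)) rs (length rs))
      (trans (cong (λ n → + n / length rs)
               (#fibres-length rs (DecUniqueₚ.deduplicate-! _≟_ (map f rs))
                 (All.tabulate λ r∈ → ∈-deduplicate⁺ _≟_ (∈-map⁺ f r∈))))
             (n/n (length rs)))

  uniform-sound : ∀ rs .{{_ : NonZero (length rs)}} {a} →
                  0ℚ < weight (finSupp (uniform rs)) a → ∃[ r ] f r ≡ a
  uniform-sound rs {a} 0<a with fibre rs a in eq
  ... | []    = contradiction 0<a (subst (λ q → ¬ 0ℚ < q) (sym (ℚₚ.0/n≡0 (length rs))) (ℚₚ.<-irrefl refl))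
  ... | r ∷ _ = r , proj₂ (∈-filter⁻ (λ r → f r ≟ a) {xs = rs} (subst (r ∈_) (sym eq) (here refl)))

------------------------------------------------------------------------
-- The uniform strategy, restricted to a β-closed set Q of terms.

module Uniform (Q : Term → Set) (closed : Q Respects _→β_) where

  ars : ARS
  ars = record
    { Carrier   = Refinement Term Q
    ; countable = mk↣ (value-injective ∘ Injection.injective Term-countable)
    ; _≟_       = Refinement._≟_ _≟ₜ_
    ; _⟶_       = λ M N → value M →β value N
    }

  open ARS ars

  fireIn : (M : Carrier) → Redex (value M) → Carrier
  fireIn M R = fire R ∣ Irrelevant.map (closed (R , refl)) (proof M)

  U : (M : Carrier) → List (Redex (value M)) → Maybe (Distribution Carrier)
  U M []         = nothing
  U M Rs@(_ ∷ _) = just (uniform _≟_ (fireIn M) Rs)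

  private
    U-nf : ∀ M Rs → (∀ R → R ∈ Rs) → U M Rs ≡ nothing ⇔ IsNormalForm _⟶_ M
    U-nf M []       all = mk⇔ (λ _ (_ , R , _) → contradiction (all R) λ ()) (λ _ → refl)
    U-nf M (R ∷ Rs) all = mk⇔ (λ ()) (λ nf → contradiction (fireIn M R , R , refl) nf)

    U-sound : ∀ M Rs {μ} → U M Rs ≡ just μ → ∀ {N} → 0ℚ < weight (finSupp μ) N → M ⟶ N
    U-sound M Rs@(_ ∷ _) refl 0<N with uniform-sound _≟_ (fireIn M) Rs 0<N
    ... | R , refl = R , refl

  strategy : RandomisedStrategy ars
  strategy = record
    { P            = λ M → U M (redexes (value M))
    ; undefined⇔nf = λ M → U-nf M (redexes (value M)) redexes-complete
    ; sound        = λ {M} → U-sound M (redexes (value M))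
    }

  fpars : FPARS
  fpars = record { ars = ars ; strategy = strategy }

Λ-WN,U : FPARS
Λ-WN,U = Uniform.fpars WN WN-closed

-- Put E = λx.(xx)(xx), so that EE → (EE)(EE).  The reducts of (λz.y)(EE) other
-- than y are the terms (λz.y)T with T a binary tree of leaves EE.  The leaves
-- are the redexes of T, and firing one of them adds one leaf.  So with k leaves
-- the computation survives one step with probability k/(k+1), and n steps with
-- probability at least k/(k+n).  Hence |ρ n| ≥ 1/(1+n), and the harmonic series
-- diverges.

{-# OPTIONS --safe #-}
module Submission where

open import Algebra.Bundles using (CommutativeMonoid)
open import Defs
open import Data.Integer.Base as ℤ using (+_; -[1+_])
import Data.Integer.Properties as ℤₚ
open import Data.Integer.Solver using (module +-*-Solver)
open import Data.Irrelevant using ([_])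
open import Data.List.Base using (List; []; _∷_; _++_; map; length)
open import Data.List.Membership.Propositional using (_∈_; lose)
open import Data.List.Membership.Propositional.Properties
  using (∈-map⁺; ∈-concatMap⁺; ∈-deduplicate⁺)
open import Data.List.Properties using (foldr-map; length-++; length-map)
open import Data.List.Relation.Unary.All as All using ([]; _∷_)
open import Data.List.Relation.Unary.AllPairs using (_∷_)
open import Data.List.Relation.Unary.Any using (here; there)
open import Data.List.Relation.Unary.Unique.Propositional using (Unique)
open import Data.Maybe.Base using (maybe′)
open import Data.Nat.Base as ℕ using (ℕ; zero; suc; NonZero)
import Data.Nat.Properties as ℕₚ
import Data.Nat.Solver as ℕSolver
open import Data.Product.Base using (∃-syntax; _,_)
open import Data.Rational.Base
  using (ℚ; mkℚ; 0ℚ; 1ℚ; _/_; _+_; _*_; _≤_; _<_; toℚᵘ; fromℚᵘ)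
import Data.Rational.Properties as ℚₚ
open import Data.Rational.Unnormalised.Base as ℚᵘ using (mkℚᵘ)
import Data.Rational.Unnormalised.Properties as ℚᵘₚ
open import Data.Refinement using (value) renaming (_,_ to _∣_)
open import Function.Base using (_∘_; const)
open import Relation.Binary.Construct.Closure.ReflexiveTransitive using (ε; _◅_)
open import Relation.Binary.Definitions using (DecidableEquality)
open import Relation.Binary.PropositionalEquality
  using (_≡_; _≢_; refl; sym; trans; cong; cong₂; subst; module ≡-Reasoning)
open import Relation.Nullary using (¬_; yes; no; contradiction)

-- Rational arithmetic

-- A fraction `+ m / n` is `fromℚᵘ` of the unnormalised fraction. With the homomorphism laws,
-- equations between fractions become integer identities, and lowest terms play no part.
fromℚᵘ-homo-+ : ∀ p q → fromℚᵘ (p ℚᵘ.+ q) ≡ fromℚᵘ p + fromℚᵘ q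
fromℚᵘ-homo-+ p q = ℚₚ.toℚᵘ-injective (begin
  toℚᵘ (fromℚᵘ (p ℚᵘ.+ q))               ≈⟨ ℚₚ.toℚᵘ-fromℚᵘ (p ℚᵘ.+ q) ⟩
  p ℚᵘ.+ q                               ≈⟨ ℚᵘₚ.+-cong (ℚₚ.toℚᵘ-fromℚᵘ p) (ℚₚ.toℚᵘ-fromℚᵘ q) ⟨
  toℚᵘ (fromℚᵘ p) ℚᵘ.+ toℚᵘ (fromℚᵘ q)   ≈⟨ ℚₚ.toℚᵘ-homo-+ (fromℚᵘ p) (fromℚᵘ q) ⟨
  toℚᵘ (fromℚᵘ p + fromℚᵘ q)             ∎)
  where open ℚᵘₚ.≃-Reasoning

fromℚᵘ-homo-* : ∀ p q → fromℚᵘ (p ℚᵘ.* q) ≡ fromℚᵘ p * fromℚᵘ q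
fromℚᵘ-homo-* p q = ℚₚ.toℚᵘ-injective (begin
  toℚᵘ (fromℚᵘ (p ℚᵘ.* q))               ≈⟨ ℚₚ.toℚᵘ-fromℚᵘ (p ℚᵘ.* q) ⟩
  p ℚᵘ.* q                               ≈⟨ ℚᵘₚ.*-cong (ℚₚ.toℚᵘ-fromℚᵘ p) (ℚₚ.toℚᵘ-fromℚᵘ q) ⟨
  toℚᵘ (fromℚᵘ p) ℚᵘ.* toℚᵘ (fromℚᵘ q)   ≈⟨ ℚₚ.toℚᵘ-homo-* (fromℚᵘ p) (fromℚᵘ q) ⟨
  toℚᵘ (fromℚᵘ p * fromℚᵘ q)             ∎)
  where open ℚᵘₚ.≃-Reasoning

/-suc : ∀ m n .{{_ : NonZero n}} → + suc m / n ≡ + 1 / n + + m / n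
/-suc m n@(suc n-1) =
  trans (ℚₚ.fromℚᵘ-cong {mkℚᵘ (+ suc m) n-1} {mkℚᵘ (+ 1) n-1 ℚᵘ.+ mkℚᵘ (+ m) n-1} (ℚᵘ.*≡* eq))
        (fromℚᵘ-homo-+ (mkℚᵘ (+ 1) n-1) (mkℚᵘ (+ m) n-1))
  where
  open +-*-Solver
  eq : + suc m ℤ.* (+ n ℤ.* + n) ≡ (+ 1 ℤ.* + n ℤ.+ + m ℤ.* + n) ℤ.* + n
  eq = solve 2 (λ m n → (con (+ 1) :+ m) :* (n :* n) := (con (+ 1) :* n :+ m :* n) :* n)
             refl (+ m) (+ n)

1/n*n/m : ∀ n m .{{_ : NonZero n}} .{{_ : NonZero m}} → + 1 / n * (+ n / m) ≡ + 1 / m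
1/n*n/m n@(suc n-1) m@(suc m-1) =
  trans (sym (fromℚᵘ-homo-* (mkℚᵘ (+ 1) n-1) (mkℚᵘ (+ n) m-1)))
        (ℚₚ.fromℚᵘ-cong {mkℚᵘ (+ 1) n-1 ℚᵘ.* mkℚᵘ (+ n) m-1} {mkℚᵘ (+ 1) m-1} (ℚᵘ.*≡* eq))
  where
  eq : + 1 ℤ.* + n ℤ.* + m ≡ + 1 ℤ.* (+ n ℤ.* + m)
  eq = ℤₚ.*-assoc (+ 1) (+ n) (+ m)

/-mono-≤ : ∀ a b c d .{{_ : NonZero b}} .{{_ : NonZero d}} → a ℕ.* d ℕ.≤ c ℕ.* b → + a / b ≤ + c / d
/-mono-≤ a b@(suc b-1) c d@(suc d-1) ad≤cb = ℚₚ.toℚᵘ-cancel-≤ (begin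
  toℚᵘ (+ a / b)   ≃⟨ ℚₚ.toℚᵘ-fromℚᵘ (mkℚᵘ (+ a) b-1) ⟩
  mkℚᵘ (+ a) b-1   ≤⟨ ℚᵘ.*≤* (from-ℕ (ℤ.+≤+ ad≤cb)) ⟩
  mkℚᵘ (+ c) d-1   ≃⟨ ℚₚ.toℚᵘ-fromℚᵘ (mkℚᵘ (+ c) d-1) ⟨
  toℚᵘ (+ c / d)   ∎)
  where
  open ℚᵘₚ.≤-Reasoning
  from-ℕ : + (a ℕ.* d) ℤ.≤ + (c ℕ.* b) → + a ℤ.* + d ℤ.≤ + c ℤ.* + b
  from-ℕ rewrite ℤₚ.pos-* a d | ℤₚ.pos-* c b = λ p → p

unbounded-/2 : ∀ q → ∃[ j ] q < + j / 2
unbounded-/2 q@(mkℚ n d-1 _) = j , ℚₚ.toℚᵘ-cancel-< (begin-strict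
  mkℚᵘ n d-1        <⟨ ℚᵘ.*<* n*2<j*d ⟩
  mkℚᵘ (+ j) 1      ≃⟨ ℚₚ.toℚᵘ-fromℚᵘ (mkℚᵘ (+ j) 1) ⟨
  toℚᵘ (+ j / 2)    ∎)
  where
  open ℚᵘₚ.≤-Reasoning
  -- Then j/2 = |n| + 1, which exceeds |n| and hence q.
  j = suc ℤ.∣ n ∣ ℕ.* 2
  i≤∣i∣ : ∀ i → i ℤ.≤ + ℤ.∣ i ∣
  i≤∣i∣ (+ _)    = ℤₚ.≤-refl
  i≤∣i∣ -[1+ _ ] = ℤ.-≤+
  n*2<j*d : n ℤ.* + 2 ℤ.< + j ℤ.* + suc d-1
  n*2<j*d = ℤₚ.≤-<-trans (ℤₚ.*-monoʳ-≤-nonNeg (+ 2) (i≤∣i∣ n))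
    (from-ℕ (ℤ.+<+ (ℕₚ.<-≤-trans (ℕₚ.m<n+m (ℤ.∣ n ∣ ℕ.* 2) {2} ℕ.z<s) (ℕₚ.m≤m*n j (suc d-1)))))
    where
    from-ℕ : + (ℤ.∣ n ∣ ℕ.* 2) ℤ.< + (j ℕ.* suc d-1) → + ℤ.∣ n ∣ ℤ.* + 2 ℤ.< + j ℤ.* + suc d-1
    from-ℕ rewrite ℤₚ.pos-* ℤ.∣ n ∣ 2 | ℤₚ.pos-* j (suc d-1) = λ p → p

-- Finite sums

module _ {A : Set} where

  ∑-cong : ∀ (xs : List A) {f g : A → ℚ} → (∀ {x} → x ∈ xs → f x ≡ g x) → ∑[ xs ] f ≡ ∑[ xs ] g
  ∑-cong []       f≡g = refl
  ∑-cong (x ∷ xs) f≡g = cong₂ _+_ (f≡g (here refl)) (∑-cong xs (f≡g ∘ there))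

  ∑-zero : ∀ (xs : List A) → ∑[ xs ] (const 0ℚ) ≡ 0ℚ
  ∑-zero []       = refl
  ∑-zero (x ∷ xs) = trans (ℚₚ.+-identityˡ _) (∑-zero xs)

  ∑-+ : ∀ (xs : List A) (f g : A → ℚ) → ∑[ xs ] (λ x → f x + g x) ≡ ∑[ xs ] f + ∑[ xs ] g
  ∑-+ []       f g = refl
  ∑-+ (x ∷ xs) f g = begin
    f x + g x + ∑[ xs ] (λ x → f x + g x)  ≡⟨ cong (λ s → f x + g x + s) (∑-+ xs f g) ⟩
    f x + g x + (∑[ xs ] f + ∑[ xs ] g)    ≡⟨ interchange (f x) (g x) (∑[ xs ] f) (∑[ xs ] g) ⟩
    f x + ∑[ xs ] f + (g x + ∑[ xs ] g)    ∎
    where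
    open ≡-Reasoning
    open import Algebra.Properties.CommutativeSemigroup
      (CommutativeMonoid.commutativeSemigroup ℚₚ.+-0-commutativeMonoid) using (interchange)

  *-distribˡ-∑ : ∀ c (xs : List A) f → c * ∑[ xs ] f ≡ ∑[ xs ] λ x → c * f x
  *-distribˡ-∑ c []       f = ℚₚ.*-zeroʳ c
  *-distribˡ-∑ c (x ∷ xs) f =
    trans (ℚₚ.*-distribˡ-+ c (f x) _) (cong (_+_ (c * f x)) (*-distribˡ-∑ c xs f))

  *-distribʳ-∑ : ∀ c (xs : List A) f → ∑[ xs ] f * c ≡ ∑[ xs ] λ x → f x * c
  *-distribʳ-∑ c []       f = ℚₚ.*-zeroˡ c
  *-distribʳ-∑ c (x ∷ xs) f =
    trans (ℚₚ.*-distribʳ-+ c (f x) _) (cong (_+_ (f x * c)) (*-distribʳ-∑ c xs f))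

  ∑-map : ∀ {B : Set} (f : A → ℚ) (g : B → A) xs → ∑[ map g xs ] f ≡ ∑[ xs ] (f ∘ g)
  ∑-map f g xs = foldr-map (λ x s → f x + s) g 0ℚ xs

  ∑-mono-≤ : ∀ (xs : List A) {f g : A → ℚ} → (∀ x → f x ≤ g x) → ∑[ xs ] f ≤ ∑[ xs ] g
  ∑-mono-≤ []       f≤g = ℚₚ.≤-refl
  ∑-mono-≤ (x ∷ xs) f≤g = ℚₚ.+-mono-≤ (f≤g x) (∑-mono-≤ xs f≤g)

  ∑-1/n : ∀ (xs : List A) n .{{_ : NonZero n}} → ∑[ xs ] (const (+ 1 / n)) ≡ + length xs / n
  ∑-1/n []       n = sym (ℚₚ.0/n≡0 n)
  ∑-1/n (x ∷ xs) n = trans (cong (_+_ (+ 1 / n)) (∑-1/n xs n)) (sym (/-suc (length xs) n))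

  -- The functions differ only at x, and x occurs exactly once in the list, so the difference y is
  -- counted once.
  ∑-update : ∀ {xs : List A} {x y f g} → Unique xs → x ∈ xs → (∀ {a} → a ≢ x → f a ≡ g a) →
             f x ≡ y + g x → ∑[ xs ] f ≡ y + ∑[ xs ] g
  ∑-update {x ∷ xs} {y = y} {g = g} (x# ∷ _) (here refl) f≡g fx =
    trans (cong₂ _+_ fx (∑-cong xs λ a∈ → f≡g λ { refl → All.lookup x# a∈ refl }))
          (ℚₚ.+-assoc y (g x) _)
  ∑-update {z ∷ xs} {x} {y} {f} {g} (z# ∷ xs!) (there x∈) f≡g fx = begin
    f z + ∑[ xs ] f        ≡⟨ cong₂ _+_ (f≡g λ { refl → All.lookup z# x∈ refl }) (∑-update {y = y} xs! x∈ f≡g fx) ⟩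
    g z + (y + ∑[ xs ] g)  ≡⟨ ℚₚ.+-assoc (g z) y _ ⟨
    g z + y + ∑[ xs ] g    ≡⟨ cong (_+ ∑[ xs ] g) (ℚₚ.+-comm (g z) y) ⟩
    y + g z + ∑[ xs ] g    ≡⟨ ℚₚ.+-assoc y (g z) _ ⟩
    y + (g z + ∑[ xs ] g)  ∎
    where open ≡-Reasoning

∑-swap : ∀ {A B : Set} (xs : List A) (ys : List B) (f : A → B → ℚ) →
         ∑[ xs ] (λ x → ∑[ ys ] (f x)) ≡ ∑[ ys ] λ y → ∑[ xs ] λ x → f x y
∑-swap []       ys f = sym (∑-zero ys)
∑-swap (x ∷ xs) ys f =
  trans (cong (_+_ (∑[ ys ] (f x))) (∑-swap xs ys f)) (sym (∑-+ ys (f x) _))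

-- The value 0 on the empty list matches `ℙ`, which is 0 at normal forms.
average : ∀ {R : Set} → List R → (R → ℚ) → ℚ
average []         f = 0ℚ
average rs@(_ ∷ _) f = + 1 / length rs * ∑[ rs ] f

average-nonNeg : ∀ {R : Set} (rs : List R) {f : R → ℚ} → (∀ r → 0ℚ ≤ f r) → 0ℚ ≤ average rs f
average-nonNeg []         0≤f = ℚₚ.≤-refl
average-nonNeg rs@(_ ∷ _) {f} 0≤f = begin
  0ℚ                                   ≡⟨ ℚₚ.*-zeroʳ (+ 1 / length rs) ⟨
  + 1 / length rs * 0ℚ                 ≡⟨ cong (+ 1 / length rs *_) (∑-zero rs) ⟨
  + 1 / length rs * ∑[ rs ] (const 0ℚ) ≤⟨ ℚₚ.*-monoˡ-≤-nonNeg (+ 1 / length rs)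
                                             {{ℚₚ.normalize-nonNeg 1 (length rs)}} (∑-mono-≤ rs 0≤f) ⟩
  + 1 / length rs * ∑[ rs ] f          ∎
  where open ℚₚ.≤-Reasoning

module _ {R A : Set} (_≟_ : DecidableEquality A) (f : R → A) where

  -- Change of variables for the image of a uniform distribution. Each r enlarges only the fibre
  -- over `f r`, so it contributes g (f r) / n. The denominator n is independent of rs so that it
  -- stays fixed in the induction.
  ∑-fibre : ∀ rs {as} n .{{_ : NonZero n}} (g : A → ℚ) → Unique as → (∀ {r} → r ∈ rs → f r ∈ as) →
            ∑[ as ] (λ a → + length (fibre _≟_ f rs a) / n * g a) ≡ + 1 / n * ∑[ rs ] (g ∘ f)
  ∑-fibre [] {as} n g as! f∈ = begin
    ∑[ as ] (λ a → + 0 / n * g a)  ≡⟨ ∑-cong as (λ {a} _ → trans (cong (_* g a) (ℚₚ.0/n≡0 n)) (ℚₚ.*-zeroˡ (g a))) ⟩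
    ∑[ as ] (const 0ℚ)             ≡⟨ ∑-zero as ⟩
    0ℚ                             ≡⟨ ℚₚ.*-zeroʳ (+ 1 / n) ⟨
    + 1 / n * 0ℚ                   ∎
    where open ≡-Reasoning
  ∑-fibre (r ∷ rs) {as} n g as! f∈ = begin
    ∑[ as ] (λ a → + length (fibre _≟_ f (r ∷ rs) a) / n * g a)
      ≡⟨ ∑-update {y = + 1 / n * g (f r)} as! (f∈ (here refl)) other this ⟩
    + 1 / n * g (f r) + ∑[ as ] (λ a → + length (fibre _≟_ f rs a) / n * g a)
      ≡⟨ cong (_+_ (+ 1 / n * g (f r))) (∑-fibre rs n g as! (f∈ ∘ there)) ⟩
    + 1 / n * g (f r) + + 1 / n * ∑[ rs ] (g ∘ f)
      ≡⟨ ℚₚ.*-distribˡ-+ (+ 1 / n) (g (f r)) _ ⟨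
    + 1 / n * (g (f r) + ∑[ rs ] (g ∘ f)) ∎
    where
    open ≡-Reasoning
    other : ∀ {a} → a ≢ f r → + length (fibre _≟_ f (r ∷ rs) a) / n * g a
                            ≡ + length (fibre _≟_ f rs a) / n * g a
    other {a} a≢ with f r ≟ a
    ... | yes fr≡a = contradiction (sym fr≡a) a≢
    ... | no  _    = refl
    this : + length (fibre _≟_ f (r ∷ rs) (f r)) / n * g (f r)
         ≡ + 1 / n * g (f r) + + length (fibre _≟_ f rs (f r)) / n * g (f r)
    this with f r ≟ f r
    ... | yes _  = trans (cong (_* g (f r)) (/-suc (length (fibre _≟_ f rs (f r))) n))
                         (ℚₚ.*-distribʳ-+ (g (f r)) (+ 1 / n) _)
    ... | no  fr≢fr = contradiction refl fr≢fr

-- Survival probabilities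

open FPARS Λ-WN,U
open Uniform WN WN-closed using (U; fireIn)

-- The probability that n steps can be made from M, by conditioning on the first step. It lives on
-- bare terms, free of supports and of proofs of weak normalisation.
survive : ℕ → Term → ℚ
survive zero    M = 1ℚ
survive (suc n) M = average (redexes M) (survive n ∘ fire)

survive-nonNeg : ∀ n M → 0ℚ ≤ survive n M
survive-nonNeg zero    M = ℚₚ.nonNegative⁻¹ 1ℚ
survive-nonNeg (suc n) M = average-nonNeg (redexes M) (survive-nonNeg n ∘ fire)

-- Ns may exceed the successors of M: it will be the support of `next ρ`, which collects the
-- successors of all points of ρ.
∑-ℙ : ∀ M {Ns} (g : Carrier → ℚ) → Unique Ns → (∀ {N} → N ∈ successors M → N ∈ Ns) →
      ∑[ Ns ] (λ N → ℙ M N * g N) ≡ average (redexes (value M)) (g ∘ fireIn M)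
∑-ℙ M {Ns} g Ns! ⊆Ns = go (redexes (value M)) ⊆Ns
  where
  -- Both sides branch on whether the list of redexes is empty; with a variable in its place, one
  -- case split reduces both.
  go : ∀ Rs → (∀ {N} → N ∈ maybe′ (support ∘ finSupp) [] (U M Rs) → N ∈ Ns) →
       ∑[ Ns ] (λ N → maybe′ (λ μ → weight (finSupp μ) N) 0ℚ (U M Rs) * g N) ≡ average Rs (g ∘ fireIn M)
  go []         _   = trans (∑-cong Ns λ {N} _ → ℚₚ.*-zeroˡ (g N)) (∑-zero Ns)
  go Rs@(_ ∷ _) ⊆Ns = ∑-fibre _≟_ (fireIn M) Rs (length Rs) g Ns!
    (⊆Ns ∘ ∈-deduplicate⁺ _≟_ ∘ ∈-map⁺ (fireIn M))

expectation : FinSupp Carrier → (Carrier → ℚ) → ℚ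
expectation ρ g = ∑[ support ρ ] λ M → weight ρ M * g M

-- Exchanging the two sums moves the transition from the distribution to the function: one step
-- forward for ρ is one averaging step for g.
expectation-next : ∀ ρ g → expectation (next ρ) g
                         ≡ expectation ρ λ M → average (redexes (value M)) (g ∘ fireIn M)
expectation-next ρ g = begin
  ∑[ Ns ] (λ N → ∑[ Ms ] (λ M → w M * ℙ M N) * g N)
    ≡⟨ ∑-cong Ns (λ {N} _ → *-distribʳ-∑ (g N) Ms λ M → w M * ℙ M N) ⟩
  ∑[ Ns ] (λ N → ∑[ Ms ] λ M → w M * ℙ M N * g N)
    ≡⟨ ∑-swap Ns Ms (λ N M → w M * ℙ M N * g N) ⟩
  ∑[ Ms ] (λ M → ∑[ Ns ] λ N → w M * ℙ M N * g N)
    ≡⟨ ∑-cong Ms (λ {M} M∈ → begin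
         ∑[ Ns ] (λ N → w M * ℙ M N * g N)
           ≡⟨ ∑-cong Ns (λ {N} _ → ℚₚ.*-assoc (w M) (ℙ M N) (g N)) ⟩
         ∑[ Ns ] (λ N → w M * (ℙ M N * g N))
           ≡⟨ *-distribˡ-∑ (w M) Ns _ ⟨
         w M * ∑[ Ns ] (λ N → ℙ M N * g N)
           ≡⟨ cong (w M *_) (∑-ℙ M g (unique (next ρ)) λ N∈ →
                ∈-deduplicate⁺ _≟_ (∈-concatMap⁺ successors (lose M∈ N∈))) ⟩
         w M * average (redexes (value M)) (g ∘ fireIn M) ∎) ⟩
  ∑[ Ms ] (λ M → w M * average (redexes (value M)) (g ∘ fireIn M)) ∎
  where
  open ≡-Reasoning
  Ns = support (next ρ)
  Ms = support ρ
  w  = weight ρ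

expectation-dirac : ∀ M g → expectation (dirac M) g ≡ g M
-- Equality on `Carrier` compares values, so this is the test made inside `dirac`.
expectation-dirac M g with value M ≟ₜ value M
... | yes _   = trans (ℚₚ.+-identityʳ _) (ℚₚ.*-identityˡ (g M))
... | no  M≢M = contradiction refl M≢M

-- The i steps are moved one by one from the distribution to the function. Each adds 1 to the
-- argument of `survive`, hence the general n.
expectation-computation : ∀ M i n →
  expectation (computation M i) (survive n ∘ value) ≡ survive (i ℕ.+ n) (value M)
expectation-computation M zero    n = expectation-dirac M (survive n ∘ value)
expectation-computation M (suc i) n = begin
  expectation (next (computation M i)) (survive n ∘ value)  ≡⟨ expectation-next (computation M i) _ ⟩
  expectation (computation M i) (survive (suc n) ∘ value)   ≡⟨ expectation-computation M i (suc n) ⟩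
  survive (i ℕ.+ suc n) (value M)                           ≡⟨ cong (λ j → survive j (value M)) (ℕₚ.+-suc i n) ⟩
  survive (suc i ℕ.+ n) (value M)                           ∎
  where open ≡-Reasoning

mass-computation : ∀ M n → mass (computation M n) ≡ survive n (value M)
mass-computation M n = begin
  mass ρ                       ≡⟨ ∑-cong (support ρ) (λ {N} _ → sym (ℚₚ.*-identityʳ (weight ρ N))) ⟩
  -- The constant 1 is `survive 0`.
  expectation ρ (const 1ℚ)     ≡⟨ expectation-computation M n 0 ⟩
  survive (n ℕ.+ 0) (value M)  ≡⟨ cong (λ j → survive j (value M)) (ℕₚ.+-identityʳ n) ⟩
  survive n (value M)          ∎
  where
  open ≡-Reasoning
  ρ = computation M n

-- The counterexample

E : Term
E = ƛ (var 0 · var 0 · (var 0 · var 0))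

-- Tree n M: M is a binary tree with n + 1 leaves EE.
data Tree : ℕ → Term → Set where
  leaf : Tree 0 (E · E)
  node : ∀ {m n S T} → Tree m S → Tree n T → Tree (suc (m ℕ.+ n)) (S · T)

-- A redex of a tree can only be a leaf, and firing it turns `E · E` into a node with two leaves.
Tree-fire : ∀ {n T} → Tree n T → (R : Redex T) → Tree (suc n) (fire R)
Tree-fire leaf root = node leaf leaf
-- `E` is normal, so neither copy contains a redex.
Tree-fire leaf (left (under (left (left ()))))
Tree-fire leaf (left (under (left (right ()))))
Tree-fire leaf (left (under (right (left ()))))
Tree-fire leaf (left (under (right (right ()))))
Tree-fire leaf (right (under (left (left ()))))
Tree-fire leaf (right (under (left (right ()))))
Tree-fire leaf (right (under (right (left ()))))
Tree-fire leaf (right (under (right (right ()))))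
-- A tree is an application, so the left child of a node is no abstraction.
Tree-fire (node () t) root
Tree-fire (node s t) (left R) = node (Tree-fire s R) t
Tree-fire (node {m} {n} {S} s t) (right R) =
  subst (λ k → Tree (suc k) (S · fire R)) (ℕₚ.+-suc m n) (node s (Tree-fire t R))

-- The redexes are exactly the leaves, of which there are n + 1.
length-redexes-Tree : ∀ {n T} → Tree n T → length (redexes T) ≡ suc n
length-redexes-Tree leaf = refl
length-redexes-Tree (node {m} {n} {S} {T} s t) = begin
  length (rootRedexes S T ++ map left (redexes S) ++ map right (redexes T))
    ≡⟨ cong (λ Rs → length (Rs ++ map left (redexes S) ++ map right (redexes T))) (no-root s) ⟩
  length (map left (redexes S) ++ map right (redexes T))
    ≡⟨ length-++ (map left (redexes S)) ⟩
  length (map left (redexes S)) ℕ.+ length (map right (redexes T))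
    ≡⟨ cong₂ ℕ._+_ (length-map left (redexes S)) (length-map right (redexes T)) ⟩
  length (redexes S) ℕ.+ length (redexes T)
    ≡⟨ cong₂ ℕ._+_ (length-redexes-Tree s) (length-redexes-Tree t) ⟩
  suc m ℕ.+ suc n
    ≡⟨ ℕₚ.+-suc (suc m) n ⟩
  suc (suc (m ℕ.+ n)) ∎
  where
  open ≡-Reasoning
  no-root : ∀ {m S} → Tree m S → rootRedexes S T ≡ []
  no-root leaf       = refl
  no-root (node _ _) = refl

survive-Tree : ∀ n {k T} → Tree k T → + suc k / (suc k ℕ.+ n) ≤ survive n ((ƛ var 1) · T)
survive-Tree zero    {k} t = /-mono-≤ (suc k) (suc k ℕ.+ 0) 1 1
  (ℕₚ.≤-reflexive (trans (ℕₚ.*-identityʳ (suc k))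
                  (trans (sym (ℕₚ.+-identityʳ (suc k))) (sym (ℕₚ.*-identityˡ (suc k ℕ.+ 0))))))
survive-Tree (suc n) {k} {T} t
  -- The redexes are the root and the k + 1 leaves of T, so `average` divides by c = k + 2.
  rewrite length-map (right {M = ƛ var 1}) (redexes T) | length-redexes-Tree t = begin
  + suc k / (suc k ℕ.+ suc n)
    ≡⟨ cong (λ l → + suc k / suc l) (ℕₚ.+-suc k n) ⟩
  + suc k / d
    ≡⟨ cong (λ l → + l / d) (length-redexes-Tree t) ⟨
  + length (redexes T) / d
    ≡⟨ ∑-1/n (redexes T) d ⟨
  ∑[ redexes T ] (const (+ 1 / d))
    -- The factor c also counts the leaves after one firing, so c/d is the bound that the induction
    -- hypothesis gives for each reduct.
    ≡⟨ ∑-cong (redexes T) (λ _ → sym (1/n*n/m c d)) ⟩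
  ∑[ redexes T ] (const (+ 1 / c * (+ c / d)))
    ≡⟨ *-distribˡ-∑ (+ 1 / c) (redexes T) (const (+ c / d)) ⟨
  + 1 / c * ∑[ redexes T ] (const (+ c / d))
    ≤⟨ scale (∑-mono-≤ (redexes T) (λ R → survive-Tree n (Tree-fire t R))) ⟩
  + 1 / c * ∑[ redexes T ] (λ R → survive n ((ƛ var 1) · fire R))
    ≡⟨ cong (+ 1 / c *_) (∑-map (survive n ∘ fire) right (redexes T)) ⟨
  + 1 / c * ∑[ map right (redexes T) ] (survive n ∘ fire)
    ≡⟨ cong (+ 1 / c *_) (ℚₚ.+-identityˡ _) ⟨
  + 1 / c * (0ℚ + ∑[ map right (redexes T) ] (survive n ∘ fire))
    -- Firing the root erases T and leaves `var 0`, whose contribution is bounded below by 0.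
    ≤⟨ scale (ℚₚ.+-monoˡ-≤ _ (survive-nonNeg n (var 0))) ⟩
  + 1 / c * (survive n (var 0) + ∑[ map right (redexes T) ] (survive n ∘ fire)) ∎
  where
  open ℚₚ.≤-Reasoning
  c d : ℕ
  c = suc (suc k)
  d = suc (suc k) ℕ.+ n
  scale : ∀ {p q} → p ≤ q → + 1 / c * p ≤ + 1 / c * q
  scale = ℚₚ.*-monoˡ-≤-nonNeg (+ 1 / c) {{ℚₚ.normalize-nonNeg 1 c}}

K : Carrier
-- The index 1 under the binder is the free variable 0, so the root redex erases `E · E` and reaches
-- the normal form `var 0`.
K = (ƛ var 1) · (E · E) ∣ [ var 0 , (λ { (_ , () , _) }) , (root , refl) ◅ ε ]

-- Comparison with the harmonic series

1/n≤mass : ∀ n → + 1 / suc n ≤ mass (computation K n)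
1/n≤mass n = subst (+ 1 / suc n ≤_) (sym (mass-computation K n)) (survive-Tree n leaf)

-- The m terms after the n-th have indices at most l, so each is at least 1/(l + 1).
partialSteps-+ : ∀ l n m → n ℕ.+ m ℕ.≤ l → partialSteps K n + + m / suc l ≤ partialSteps K (n ℕ.+ m)
partialSteps-+ l n zero n≤l = ℚₚ.≤-reflexive
  (trans (cong (_+_ (partialSteps K n)) (ℚₚ.0/n≡0 (suc l)))
  (trans (ℚₚ.+-identityʳ _) (cong (partialSteps K) (sym (ℕₚ.+-identityʳ n)))))
partialSteps-+ l n (suc m) n+m≤l = begin
  partialSteps K n + + suc m / suc l
    ≡⟨ cong (_+_ (partialSteps K n)) (trans (/-suc m (suc l)) (ℚₚ.+-comm (+ 1 / suc l) _)) ⟩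
  partialSteps K n + (+ m / suc l + + 1 / suc l)
    ≡⟨ ℚₚ.+-assoc (partialSteps K n) _ _ ⟨
  partialSteps K n + + m / suc l + + 1 / suc l
    ≤⟨ ℚₚ.+-mono-≤ (partialSteps-+ l n m (ℕₚ.<⇒≤ n+m<l))
         (ℚₚ.≤-trans (/-mono-≤ 1 (suc l) 1 (suc (suc (n ℕ.+ m))) (ℕₚ.*-monoʳ-≤ 1 (ℕ.s≤s n+m<l)))
                     (1/n≤mass (suc (n ℕ.+ m)))) ⟩
  partialSteps K (suc (n ℕ.+ m))
    ≡⟨ cong (partialSteps K) (ℕₚ.+-suc n m) ⟨
  partialSteps K (n ℕ.+ suc m) ∎
  where
  open ℚₚ.≤-Reasoning
  n+m<l : n ℕ.+ m ℕ.< l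
  n+m<l = subst (ℕ._≤ l) (ℕₚ.+-suc n m) n+m≤l

-- Oresme's grouping: the n + 1 terms with indices from n + 1 to 2n + 1 are each at least 1/(2n +
-- 2), which gives 1/2 in all.
partialSteps-double : ∀ n → partialSteps K n + + 1 / 2 ≤ partialSteps K (n ℕ.+ suc n)
partialSteps-double n = ℚₚ.≤-trans
  (ℚₚ.+-monoʳ-≤ (partialSteps K n) (/-mono-≤ 1 2 (suc n) (suc (n ℕ.+ suc n)) (ℕₚ.≤-reflexive eq)))
  (partialSteps-+ (n ℕ.+ suc n) n (suc n) ℕₚ.≤-refl)
  where
  open ℕSolver.+-*-Solver
  eq : 1 ℕ.* suc (n ℕ.+ suc n) ≡ suc n ℕ.* 2
  eq = solve 1 (λ n → con 1 :* (con 1 :+ (n :+ (con 1 :+ n))) := (con 1 :+ n) :* con 2) refl n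

partialSteps-unbounded : ∀ j → ∃[ n ] + j / 2 ≤ partialSteps K n
partialSteps-unbounded zero    = 0 , ℚₚ.≤-refl
partialSteps-unbounded (suc j) with partialSteps-unbounded j
... | n , j/2≤ = n ℕ.+ suc n , (begin
  + suc j / 2                   ≡⟨ trans (/-suc j 2) (ℚₚ.+-comm (+ 1 / 2) (+ j / 2)) ⟩
  + j / 2 + + 1 / 2             ≤⟨ ℚₚ.+-monoˡ-≤ (+ 1 / 2) j/2≤ ⟩
  partialSteps K n + + 1 / 2    ≤⟨ partialSteps-double n ⟩
  partialSteps K (n ℕ.+ suc n)  ∎)
  where open ℚₚ.≤-Reasoning

proposition4 : ¬ FPARS.PAST Λ-WN,U
proposition4 past with past K
... | q , ≤q with unbounded-/2 q
...   | j , q<j/2 with partialSteps-unbounded j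
...     | n , j/2≤ = ℚₚ.<-irrefl refl (ℚₚ.<-≤-trans q<j/2 (ℚₚ.≤-trans j/2≤ (≤q n)))
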